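{- For every $n\ge 1$, the quadruple of statistics $(\mathsf{asc},\mathsf{zero},\mathsf{max},\mathsf{Rmin})$ has the same distribution as the quadruple $(\mathsf{dist},\mathsf{zero},\mathsf{max},\mathsf{Rmin})$ on the set $\mathcal{I}_n$ of inversion sequences of length $n$.
   Context: An inversion sequence of length $n$ is a sequence $s=(s_1,\dots,s_n)$ of non-negative integers with $0\le s_i<i$ for all $i$; $\mathcal{I}_n$ is the set of all of them. For $s\in\mathcal{I}_n$: $\mathsf{asc}(s)=|\{i\in[n-1]:s_i<s_{i+1}\}|$; $\mathsf{dist}(s)=|\{s_1,\dots,s_n\}|-1$ (number of distinct non-zero entries); $\mathsf{zero}(s)=|\{i\in[n]:s_i=0\}|$; $\mathsf{max}(s)=|\{i\in[n]:s_i=i-1\}|$; and $\mathsf{Rmin}(s)=\{s_i:s_i<s_j\text{ for all }j>i\}$ is the set-valued statistic of right-to-left minima. Same distribution means that each tuple of values (the last component being a set) is attained by the same number of elements of $\mathcal{I}_n$. -}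

module Defs where

open import Data.Fin.Base as Fin using (Fin; zero; suc; toℕ; inject₁)
open import Data.Fin.Properties as Fin using (all?)
open import Data.List.Base as List using (List; deduplicate; filter; length)
open import Data.List.Relation.Binary.BagAndSetEquality using (_∼[_]_; set)
open import Data.Nat.Base using (ℕ; zero; suc; _∸_; _<_)
open import Data.Nat.Properties using (_≟_; _<?_)
open import Data.Product.Base using (_×_; _,_; ∃-syntax)
open import Data.Refinement using (Refinement-syntax; value)
open import Data.Vec.Base using (Vec; []; allFin; count; lookup; toList)
open import Function.Bundles using (_⤖_)
open import Relation.Binary.PropositionalEquality.Core using (_≡_)
open import Relation.Nullary.Decidable.Core using (Dec; _→-dec_)

-- Positions are 0-based: the index i : Fin n stands for the position
-- toℕ i + 1, so that "sᵢ < i" reads lookup s i < suc (toℕ i), and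
-- "sᵢ = i - 1" reads lookup s i ≡ toℕ i.

InvSeq : ℕ → Set
InvSeq n = [ s ∈ Vec ℕ n ∣ (∀ (i : Fin n) → lookup s i < suc (toℕ i)) ]

asc : ∀ {n} → Vec ℕ n → ℕ
asc {zero}  s = 0
asc {suc m} s = count (λ i → lookup s (inject₁ i) <? lookup s (suc i)) (allFin m)

dist : ∀ {n} → Vec ℕ n → ℕ
dist s = length (deduplicate _≟_ (toList s)) ∸ 1

zeros : ∀ {n} → Vec ℕ n → ℕ
zeros {n} s = count (λ i → lookup s i ≟ 0) (allFin n)

maxs : ∀ {n} → Vec ℕ n → ℕ
maxs {n} s = count (λ i → lookup s i ≟ toℕ i) (allFin n)

IsRightToLeftMin : ∀ {n} → Vec ℕ n → Fin n → Set
IsRightToLeftMin {n} s i = ∀ (j : Fin n) → i Fin.< j → lookup s i < lookup s j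

isRightToLeftMin? : ∀ {n} (s : Vec ℕ n) (i : Fin n) → Dec (IsRightToLeftMin s i)
isRightToLeftMin? s i = all? λ j → (i Fin.<? j) →-dec (lookup s i <? lookup s j)

-- Finite sets of naturals are lists, compared by membership (see _≈_).
Rmin : ∀ {n} → Vec ℕ n → List ℕ
Rmin {n} s = List.map (lookup s) (filter (isRightToLeftMin? s) (List.allFin n))

Values : Set
Values = ℕ × ℕ × ℕ × List ℕ

infix 4 _≈_

_≈_ : Values → Values → Set
(a , z , m , R) ≈ (a′ , z′ , m′ , R′) =
  a ≡ a′ × z ≡ z′ × m ≡ m′ × R ∼[ set ] R′

asc-zero-max-Rmin : ∀ {n} → InvSeq n → Values
asc-zero-max-Rmin σ = let s = value σ in asc s , zeros s , maxs s , Rmin s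

dist-zero-max-Rmin : ∀ {n} → InvSeq n → Values
dist-zero-max-Rmin σ = let s = value σ in dist s , zeros s , maxs s , Rmin s

HasCardinality : Set → ℕ → Set
HasCardinality A k = Fin k ⤖ A

-- The condition in a refinement type is proof-irrelevant, so a sequence is
-- counted once however many proofs of F σ ≈ v there are.
Fibre : ∀ {A : Set} → (A → Values) → Values → Set
Fibre {A} F v = [ σ ∈ A ∣ F σ ≈ v ]

SameDistribution : ∀ {A : Set} → (A → Values) → (A → Values) → Set
SameDistribution F G =
  ∀ (v : Values) → ∃[ k ] HasCardinality (Fibre F v) k × HasCardinality (Fibre G v) k

{-# OPTIONS --safe #-}
-- Every sequence of length k + 1 arises from exactly one sequence of length k
-- by inserting, for a unique q ≤ k, the value q at the (0-based) position q:
-- q is the last position holding its maximal possible value.  As zero, max and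
-- Rmin are common to both quadruples, only the effect of such an insertion on asc
-- and on dist has to be compared.
--
-- Encode the positions q ≥ 1 of a sequence s by a word: the letter at q is peak
-- if s_q = q; otherwise it is used if inserting q leaves asc (respectively dist)
-- unchanged, and fresh if it increases the statistic.  Then asc (respectively
-- dist) is the number of letters that are not fresh, and inserting q makes the
-- letter at q a peak, turns the later peaks into used letters, and creates one
-- fresh letter: immediately after q for asc, at the end of the word for dist.
--
-- To see that the place of the new fresh letter is irrelevant, decide already at
-- its creation whether a fresh letter may ever be chosen, and delete it if not.
-- In the words with this choice made, all letters after q become used ones, so
-- that both rules insert the new letter in the same way.  Binomial inversion
-- (Newton's forward differences) recovers the original count.
module Submission where

open import Defs
import Algebra.Properties.AbelianGroup as AbelianGroup
import Algebra.Properties.CommutativeSemigroup as CommutativeSemigroup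
open import Data.Bool.Base using (if_then_else_; true; false)
open import Data.Empty using (⊥)
open import Data.Fin.Base using (Fin; zero; suc; toℕ; inject₁)
import Data.Fin.Properties as Fin
open import Data.Integer.Base as ℤ using (ℤ; +_; 0ℤ; 1ℤ)
import Data.Integer.Properties as ℤ
open import Data.Irrelevant using () renaming ([_] to irr)
open import Data.List.Base as List using (List; []; _∷_; [_]; _++_; concatMap; filter; length; deduplicate)
import Data.List.Properties as List
open import Data.List.Membership.DecPropositional using () renaming (_∈?_ to member?)
open import Data.List.Membership.Propositional using (_∈_; find; lose)
import Data.List.Membership.Propositional.Properties as List
open import Data.List.Membership.Propositional.Properties.WithK using (unique∧set⇒bag)
open import Data.List.Relation.Binary.BagAndSetEquality using (_∼[_]_; set; ∼bag⇒↭)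
open import Data.List.Relation.Binary.Permutation.Propositional.Properties using (↭-length)
open import Data.List.Relation.Unary.All as ListAll using ([]; _∷_)
import Data.List.Relation.Unary.All.Properties as ListAll
open import Data.List.Relation.Unary.AllPairs using ([]; _∷_)
open import Data.List.Relation.Unary.Any using (here; there; index)
open import Data.List.Relation.Unary.Any.Properties using (lookup-index)
open import Data.List.Relation.Unary.Unique.DecPropositional.Properties using (deduplicate-!; filter⁺; map⁺; ++⁺)
open import Data.List.Relation.Unary.Unique.Propositional using (Unique)
open import Data.Nat.Base using (ℕ; zero; suc; _+_; _∸_; _≤_; _<_; _≥_; z≤n; s≤s; s≤s⁻¹; z<s)
open import Data.Nat.Properties
open import Data.Product.Base using (_×_; _,_; proj₁; proj₂; ∃-syntax)
open import Data.Refinement using (value; _,_)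
open import Data.Sum.Base using (_⊎_; inj₁; inj₂; [_,_]′)
open import Data.Unit.Base using (⊤; tt)
open import Data.Vec.Base using (Vec; []; _∷_; lookup; count; allFin; tabulate; toList)
open import Data.Vec.Membership.DecPropositional _≟_ using (_∈?_)
import Data.Vec.Membership.Propositional as Vec
open import Data.Vec.Membership.Propositional.Properties using (∈-toList⁺; ∈-toList⁻)
import Data.Vec.Properties as Vec
open import Data.Vec.Relation.Unary.All as VecAll using (All; []; _∷_)
import Data.Vec.Relation.Unary.All.Properties as VecAll
open import Data.Vec.Relation.Unary.Any using (here; there)
open import Function.Base using (_∘_; id)
open import Function.Bundles using (_⇔_; mk⇔; mk⤖; Equivalence)
open import Relation.Binary.PropositionalEquality using (_≡_; refl; sym; trans; cong; cong₂; subst; module ≡-Reasoning)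
open import Relation.Nullary using (Dec; yes; no; does; ¬_; contradiction)
open import Relation.Nullary.Decidable using (does-⇔; dec-false; map′; _×-dec_; recompute)
open import Relation.Unary using (Decidable)

open AbelianGroup ℤ.+-0-abelianGroup using (xyx⁻¹≈y)
open CommutativeSemigroup ℤ.+-commutativeSemigroup using (interchange)

private variable
  n : ℕ
  P Q P′ Q′ : Set

-- Words, their splits and the markings of fresh letters

data Letter : Set where
  peak used fresh : Letter

Word : Set
Word = List Letter

demote : Letter → Letter
demote peak  = used
demote used  = used
demote fresh = fresh

peaks freshes : Word → ℕ
peaks []          = 0
peaks (peak ∷ w)  = suc (peaks w)
peaks (used ∷ w)  = peaks w
peaks (fresh ∷ w) = peaks w
freshes []          = 0
freshes (peak ∷ w)  = freshes w
freshes (used ∷ w)  = freshes w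
freshes (fresh ∷ w) = suc (freshes w)

-- One summand for each inner position at which a value can be inserted. The letter there is in
-- neither part, because a peak takes its place.
splits : (Word → Word → ℤ) → Word → ℤ
splits f []      = 0ℤ
splits f (x ∷ w) = f [] w ℤ.+ splits (λ p → f (x ∷ p)) w

splits-cong : ∀ {f g} → (∀ p s → f p s ≡ g p s) → ∀ w → splits f w ≡ splits g w
splits-cong eq []      = refl
splits-cong eq (x ∷ w) = cong₂ ℤ._+_ (eq [] w) (splits-cong (λ p → eq (x ∷ p)) w)

Marking : Set
Marking = Word → ℕ → ℤ

-- The marked fresh letters become used, the unmarked ones are deleted and counted.
markings : Word → Marking → ℤ
markings []          f = f [] 0
markings (fresh ∷ w) f = markings w (λ v → f (used ∷ v)) ℤ.+ markings w (λ v i → f v (suc i))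
markings (x ∷ w)     f = markings w (λ v → f (x ∷ v))

markings-cong : ∀ w {f g : Marking} → (∀ v i → f v i ≡ g v i) → markings w f ≡ markings w g
markings-cong []          eq = eq [] 0
markings-cong (peak ∷ w)  eq = markings-cong w (λ v → eq (peak ∷ v))
markings-cong (used ∷ w)  eq = markings-cong w (λ v → eq (used ∷ v))
markings-cong (fresh ∷ w) eq = cong₂ ℤ._+_ (markings-cong w (λ v → eq (used ∷ v)))
                                           (markings-cong w (λ v i → eq v (suc i)))

markings-+ : ∀ w (f g : Marking) → markings w (λ v i → f v i ℤ.+ g v i) ≡ markings w f ℤ.+ markings w g
markings-+ []          f g = refl
markings-+ (peak ∷ w)  f g = markings-+ w _ _
markings-+ (used ∷ w)  f g = markings-+ w _ _
markings-+ (fresh ∷ w) f g = trans (cong₂ ℤ._+_ (markings-+ w _ _) (markings-+ w _ _))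
  (interchange (markings w (λ v → f (used ∷ v))) (markings w (λ v → g (used ∷ v)))
                 (markings w (λ v i → f v (suc i))) (markings w (λ v i → g v (suc i))))

markings-++ : ∀ p w (f : Marking) →
  markings (p ++ w) f ≡ markings p (λ v i → markings w (λ u j → f (v ++ u) (i + j)))
markings-++ []          w f = refl
markings-++ (peak ∷ p)  w f = markings-++ p w _
markings-++ (used ∷ p)  w f = markings-++ p w _
markings-++ (fresh ∷ p) w f = cong₂ ℤ._+_ (markings-++ p w _) (markings-++ p w _)

clear : Word → Word
clear = List.map (λ _ → used)

-- `demote` keeps the fresh letters, and a marked one becomes used; so after demotion every letter
-- that survives the marking is used.
markings-demote : ∀ w (f : Marking) → markings (List.map demote w) f ≡ markings w (λ v → f (clear v))
markings-demote []          f = refl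
markings-demote (peak ∷ w)  f = markings-demote w _
markings-demote (used ∷ w)  f = markings-demote w _
markings-demote (fresh ∷ w) f = cong₂ ℤ._+_ (markings-demote w _) (markings-demote w _)

-- A deleted letter is no place to split, so a fresh letter at the split can only have been marked.
-- Hence that letter needs no marking on the right.
markings-splits : ∀ w (f : ℕ → Word → Word → ℤ) →
  markings w (λ v i → splits (f i) v)
    ≡ splits (λ p s → markings p (λ v i → markings s (λ u j → f (i + j) v u))) w
markings-splits []          f = refl
markings-splits (peak ∷ w)  f = trans (markings-+ w _ _) (cong (ℤ._+_ (markings w (λ u j → f j [] u))) (markings-splits w _))
markings-splits (used ∷ w)  f = trans (markings-+ w _ _) (cong (ℤ._+_ (markings w (λ u j → f j [] u))) (markings-splits w _))
markings-splits (fresh ∷ w) f = begin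
  markings w (λ v i → f i [] v ℤ.+ splits (λ p → f i (used ∷ p)) v) ℤ.+ markings w (λ v i → splits (f (suc i)) v)
    ≡⟨ cong₂ ℤ._+_ (trans (markings-+ w _ _) (cong (ℤ._+_ A) (markings-splits w _))) (markings-splits w _) ⟩
  (A ℤ.+ splits B w) ℤ.+ splits C w
    ≡⟨ ℤ.+-assoc A _ _ ⟩
  A ℤ.+ (splits B w ℤ.+ splits C w)
    ≡⟨ cong (ℤ._+_ A) (splits-+ B C w) ⟩
  A ℤ.+ splits (λ p s → B p s ℤ.+ C p s) w ∎
  where
  open ≡-Reasoning
  -- For a fresh first letter: `A` splits at it, `B` has it marked in the prefix, `C` has it
  -- deleted.
  A = markings w (λ u j → f j [] u)
  B C : Word → Word → ℤ
  B p s = markings p (λ v i → markings s (λ u j → f (i + j) (used ∷ v) u))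
  C p s = markings p (λ v i → markings s (λ u j → f (suc (i + j)) v u))
  splits-+ : ∀ (f g : Word → Word → ℤ) w → splits f w ℤ.+ splits g w ≡ splits (λ p s → f p s ℤ.+ g p s) w
  splits-+ f g []      = refl
  splits-+ f g (x ∷ w) = trans (interchange (f [] w) _ (g [] w) _) (cong (ℤ._+_ (f [] w ℤ.+ g [] w)) (splits-+ _ _ w))

-- The `i`-th forward difference of `f` at 0.
difference : ℕ → (ℕ → ℤ) → ℤ
difference zero    f = f 0
difference (suc i) f = difference i (λ j → f (suc j) ℤ.- f j)

-- Newton's forward difference formula
markings-difference : ∀ w (θ : ℕ → ℕ → ℤ) →
  markings w (λ v i → difference i (λ j → θ j (peaks v))) ≡ θ (freshes w) (peaks w)
markings-difference []          θ = refl
markings-difference (peak ∷ w)  θ = markings-difference w (λ j r → θ j (suc r))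
markings-difference (used ∷ w)  θ = markings-difference w θ
markings-difference (fresh ∷ w) θ = trans
  (cong₂ ℤ._+_ (markings-difference w θ) (markings-difference w (λ j r → θ (suc j) r ℤ.- θ j r)))
  (trans (sym (ℤ.+-assoc (θ (freshes w) (peaks w)) _ _)) (xyx⁻¹≈y (θ (freshes w) (peaks w)) _))

-- Growth of words under the two insertion rules

-- The arguments are the numbers of fresh letters, of peaks and of zeros, and the right-to-left
-- minima.
Weight : Set
Weight = ℕ → ℕ → ℕ → List ℕ → ℤ

Rule : Set
Rule = Word → Word

-- The two fates of a new fresh letter: marked, it is a used letter, by convention the last one;
-- unmarked, it is deleted and counted.
extend : Marking → Marking
extend f v i = f (v ++ [ used ]) i ℤ.+ f v (suc i)

-- That is, ρ demotes all letters and inserts a fresh one, no matter where.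
Grows : Rule → Set
Grows ρ = ∀ w (f : Marking) → markings (ρ w) f ≡ markings w (λ v → extend f (clear v))

ascRule distRule : Rule
ascRule  w = fresh ∷ List.map demote w
distRule w = List.map demote w ++ [ fresh ]

-- Among used letters the place of one more is invisible; this reconciles the front of `ascRule`
-- with the end of `distRule`.
clear-used : ∀ v → used ∷ clear v ≡ clear v ++ [ used ]
clear-used []      = refl
clear-used (x ∷ v) = cong (used ∷_) (clear-used v)

ascRule-grows : Grows ascRule
ascRule-grows w f = trans
  (cong₂ ℤ._+_ (trans (markings-demote w _) (markings-cong w (λ v i → cong (λ u → f u i) (clear-used v))))
               (markings-demote w _))
  (sym (markings-+ w _ _))

distRule-grows : Grows distRule
distRule-grows w f = trans (markings-++ (List.map demote w) [ fresh ] f)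
  (trans (markings-demote w _) (markings-cong w (λ v i → cong₂ ℤ._+_
    (cong (f _) (+-identityʳ i))
    (cong₂ f (List.++-identityʳ _) (trans (+-suc i 0) (cong suc (+-identityʳ i)))))))

module Growth (θ : Weight) where

  -- The sum of θ over all ways to insert m more values into a sequence of length k
  -- with word w, z zeros and right-to-left minima R.
  grow : Rule → (m k : ℕ) → Word → ℕ → List ℕ → ℤ
  grow ρ zero    k w z R = θ (freshes w) (peaks w) z R
  grow ρ (suc m) k w z R =
    grow ρ m (suc k) (ρ w) (suc z) R ℤ.+
    (splits (λ p s → grow ρ m (suc k) (p ++ peak ∷ ρ s) z R) w ℤ.+
     grow ρ m (suc k) (w ++ [ peak ]) z (R ++ [ k ]))

  -- The counterpart of `grow` after marking, with `i` letters deleted; no rule occurs in it. The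
  -- base case is a difference, so that summing over all markings gives back `θ`.
  growMarked : (m k : ℕ) → ℕ → List ℕ → Marking
  growMarked zero    k z R v i = difference i (λ j → θ j (peaks v) z R)
  growMarked (suc m) k z R v i =
    extend (growMarked m (suc k) (suc z) R) (clear v) i ℤ.+
    (splits (λ p s → extend (growMarked m (suc k) z R) (p ++ peak ∷ clear s) i) v ℤ.+
     growMarked m (suc k) z (R ++ [ k ]) (v ++ [ peak ]) i)

  -- Induction on `m`. The rule enters only through `Grows`, so all growing rules share one
  -- right-hand side.
  grow-markings : ∀ {ρ} → Grows ρ → ∀ m k w z R →
    grow ρ m k w z R ≡ markings w (growMarked m k z R)
  grow-markings Gρ zero    k w z R = sym (markings-difference w (λ j r → θ j r z R))
  grow-markings {ρ} Gρ (suc m) k w z R = begin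
    grow ρ (suc m) k w z R
      ≡⟨ cong₂ ℤ._+_ bottom (cong₂ ℤ._+_ middle top) ⟩
    markings w a ℤ.+ (markings w b ℤ.+ markings w c)
      ≡⟨ cong (ℤ._+_ (markings w a)) (markings-+ w b c) ⟨
    markings w a ℤ.+ markings w (λ v i → b v i ℤ.+ c v i)
      ≡⟨ markings-+ w a _ ⟨
    markings w (growMarked (suc m) k z R) ∎
    where
    open ≡-Reasoning
    a b c : Marking
    a v i = extend (growMarked m (suc k) (suc z) R) (clear v) i
    b v i = splits (λ p s → extend (growMarked m (suc k) z R) (p ++ peak ∷ clear s) i) v
    c v i = growMarked m (suc k) z (R ++ [ k ]) (v ++ [ peak ]) i
    bottom : grow ρ m (suc k) (ρ w) (suc z) R ≡ markings w a
    bottom = trans (grow-markings Gρ m _ _ _ _) (Gρ w _)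
    middle : splits (λ p s → grow ρ m (suc k) (p ++ peak ∷ ρ s) z R) w ≡ markings w b
    middle = begin
      splits (λ p s → grow ρ m (suc k) (p ++ peak ∷ ρ s) z R) w
        -- The prefix and `ρ s` are marked separately; `Grows` treats the latter, and its used
        -- letter lands at the end of the whole word.
        ≡⟨ splits-cong (λ p s → trans (grow-markings Gρ m _ _ _ _) (trans (markings-++ p _ _)
             (markings-cong p (λ v i → trans (Gρ s _) (markings-cong s (λ u j →
               cong₂ ℤ._+_ (cong (λ x → growMarked m (suc k) z R x (i + j)) (sym (List.++-assoc v (peak ∷ clear u) _)))
                           (cong (growMarked m (suc k) z R _) (+-suc i j)))))))) w ⟩
      splits (λ p s → markings p (λ v i → markings s (λ u j → extend (growMarked m (suc k) z R) (v ++ peak ∷ clear u) (i + j)))) w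
        ≡⟨ markings-splits w (λ i p s → extend (growMarked m (suc k) z R) (p ++ peak ∷ clear s) i) ⟨
      markings w b ∎
    top : grow ρ m (suc k) (w ++ [ peak ]) z (R ++ [ k ]) ≡ markings w c
    top = trans (grow-markings Gρ m _ _ _ _) (trans (markings-++ w [ peak ] _)
            (markings-cong w (λ v i → cong (growMarked m (suc k) z _ _) (+-identityʳ i))))

  grow-asc≡grow-dist : ∀ m k w z R → grow ascRule m k w z R ≡ grow distRule m k w z R
  grow-asc≡grow-dist m k w z R = trans (grow-markings ascRule-grows m k w z R)
                                       (sym (grow-markings distRule-grows m k w z R))

-- Insertion of a value at the position equal to it

infix 4 _∈ᵛ_
_∈ᵛ_ : ℕ → Vec ℕ n → Set
x ∈ᵛ s = x Vec.∈ s

-- The vector is regarded as the tail of a sequence, and `k` as the position of its first entry in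
-- the whole.
Bounded : ℕ → Vec ℕ n → Set
Bounded k []      = ⊤
Bounded k (x ∷ s) = x ≤ k × Bounded (suc k) s

insertions inner : ℕ → Vec ℕ n → List (Vec ℕ (suc n))
insertions k []      = [ k ∷ [] ]
insertions k (x ∷ s) = (k ∷ x ∷ s) ∷ List.map (x ∷_) (insertions (suc k) s)
inner k []      = []
inner k (x ∷ s) = (k ∷ x ∷ s) ∷ List.map (x ∷_) (inner (suc k) s)

top : ℕ → Vec ℕ n → Vec ℕ (suc n)
top k []      = k ∷ []
top k (x ∷ s) = x ∷ top (suc k) s

insertions-inner-top : ∀ k (s : Vec ℕ n) → insertions k s ≡ inner k s ++ [ top k s ]
insertions-inner-top k []      = refl
insertions-inner-top k (x ∷ s) = cong ((k ∷ x ∷ s) ∷_)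
  (trans (cong (List.map (x ∷_)) (insertions-inner-top (suc k) s)) (List.map-++ (x ∷_) (inner (suc k) s) _))

data Insertion : ℕ → Vec ℕ n → Vec ℕ (suc n) → Set where
  here  : ∀ {k} {s : Vec ℕ n} → Insertion k s (k ∷ s)
  there : ∀ {k x} {s : Vec ℕ n} {s′} → Insertion (suc k) s s′ → Insertion k (x ∷ s) (x ∷ s′)

inner-Insertion : ∀ k (s : Vec ℕ n) → ListAll.All (Insertion k s) (inner k s)
inner-Insertion k []      = []
inner-Insertion k (x ∷ s) = here ∷ ListAll.map⁺ (ListAll.map there (inner-Insertion (suc k) s))

top-Insertion : ∀ k (s : Vec ℕ n) → Insertion k s (top k s)
top-Insertion k []      = here
top-Insertion k (x ∷ s) = there (top-Insertion (suc k) s)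

Insertion-All⁺ : ∀ {P : ℕ → Set} {k} {s : Vec ℕ n} {s′} → Insertion k s s′ → (∀ j → k ≤ j → P j) → All P s → All P s′
Insertion-All⁺ here        Pk ps       = Pk _ ≤-refl ∷ ps
Insertion-All⁺ (there ins) Pk (p ∷ ps) = p ∷ Insertion-All⁺ ins (λ j k<j → Pk j (<⇒≤ k<j)) ps

Insertion-All⁻ : ∀ {P : ℕ → Set} {k} {s : Vec ℕ n} {s′} → Insertion k s s′ → All P s′ → All P s
Insertion-All⁻ here        (_ ∷ ps) = ps
Insertion-All⁻ (there ins) (p ∷ ps) = p ∷ Insertion-All⁻ ins ps

Insertion-∈⁺ : ∀ {j k} {s : Vec ℕ n} {s′} → Insertion k s s′ → j ∈ᵛ s → j ∈ᵛ s′
Insertion-∈⁺ here        i         = there i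
Insertion-∈⁺ (there ins) (here e)  = here e
Insertion-∈⁺ (there ins) (there i) = there (Insertion-∈⁺ ins i)

Insertion-∈⁻ : ∀ {j k} {s : Vec ℕ n} {s′} → j < k → Insertion k s s′ → j ∈ᵛ s′ → j ∈ᵛ s
Insertion-∈⁻ j<k here        (here e)  = contradiction e (<⇒≢ j<k)
Insertion-∈⁻ j<k here        (there i) = i
Insertion-∈⁻ j<k (there ins) (here e)  = here e
Insertion-∈⁻ j<k (there ins) (there i) = there (Insertion-∈⁻ (m<n⇒m<1+n j<k) ins i)

-- Zeros and right-to-left minima under insertion

count-tabulate : ∀ {m} {A : Set} {P : A → Set} (P? : Decidable P) (f : Fin m → A) →
  count P? (tabulate f) ≡ count (λ i → P? (f i)) (allFin m)
count-tabulate {zero}  P? f = refl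
count-tabulate {suc m} P? f with does (P? (f zero))
... | true  = cong suc (trans (count-tabulate P? (f ∘ suc)) (sym (count-tabulate (λ i → P? (f i)) suc)))
... | false = trans (count-tabulate P? (f ∘ suc)) (sym (count-tabulate (λ i → P? (f i)) suc))

count-allFin : ∀ {m} {P : (Fin (suc m)) → Set} (P? : Decidable P) →
  count P? (allFin (suc m)) ≡ (if does (P? zero) then suc else id) (count (λ i → P? (suc i)) (allFin m))
count-allFin P? = cong (if does (P? zero) then suc else id) (count-tabulate P? suc)

zeros-∷ : ∀ x (s : Vec ℕ n) → zeros (x ∷ s) ≡ (if does (x ≟ 0) then suc else id) (zeros s)
zeros-∷ x s = count-allFin (λ i → lookup (x ∷ s) i ≟ 0)

zeros-Insertion : ∀ {k} {s : Vec ℕ n} {s′} → Insertion (suc k) s s′ → zeros s′ ≡ zeros s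
zeros-Insertion {k = k} {s} here = zeros-∷ (suc k) s
zeros-Insertion (there {x = x} {s} {s′} ins) = begin
  zeros (x ∷ s′) ≡⟨ zeros-∷ x s′ ⟩
  _              ≡⟨ cong (if does (x ≟ 0) then suc else id) (zeros-Insertion ins) ⟩
  _              ≡⟨ zeros-∷ x s ⟨
  zeros (x ∷ s)  ∎
  where open ≡-Reasoning

below? : ∀ x (s : Vec ℕ n) → Dec (All (x <_) s)
below? x = VecAll.all? (x <?_)

rightMins : Vec ℕ n → List ℕ
rightMins []      = []
rightMins (x ∷ s) = if does (below? x s) then x ∷ rightMins s else rightMins s

-- The new value stands before an entry that does not exceed it, so it is no right-to-left minimum.
-- It is larger than every entry before it, so it disturbs none of them.
rightMins-inner : ∀ k (s : Vec ℕ n) → Bounded k s →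
  ListAll.All (λ s′ → rightMins s′ ≡ rightMins s) (inner k s)
rightMins-inner k []      _         = []
rightMins-inner k (x ∷ s) (x≤k , b) = not-min ∷ ListAll.map⁺
  (ListAll.zipWith (λ (ins , eq) → step ins eq) (inner-Insertion (suc k) s , rightMins-inner (suc k) s b))
  where
  not-min : rightMins (k ∷ x ∷ s) ≡ rightMins (x ∷ s)
  not-min rewrite dec-false (below? k (x ∷ s)) (λ { (k<x ∷ _) → <⇒≱ k<x x≤k }) = refl
  step : ∀ {s′} → Insertion (suc k) s s′ → rightMins s′ ≡ rightMins s → rightMins (x ∷ s′) ≡ rightMins (x ∷ s)
  step {s′} ins eq rewrite eq | does-⇔ (mk⇔ (Insertion-All⁻ ins) (Insertion-All⁺ ins (λ j k<j → ≤-<-trans x≤k k<j))) (below? x s′) (below? x s) = refl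

-- The appended value exceeds all entries, so the old minima survive, and being last it is a minimum
-- itself.
rightMins-top : ∀ k (s : Vec ℕ n) → Bounded k s → rightMins (top k s) ≡ rightMins s ++ [ k + n ]
rightMins-top k []      _ = cong [_] (sym (+-identityʳ k))
rightMins-top {suc n} k (x ∷ s) (x≤k , b)
  rewrite does-⇔ (mk⇔ (Insertion-All⁻ (top-Insertion (suc k) s)) (Insertion-All⁺ (top-Insertion (suc k) s) (λ j k<j → ≤-<-trans x≤k k<j))) (below? x (top (suc k) s)) (below? x s)
        | rightMins-top (suc k) s b | +-suc k n
  with does (below? x s)
... | true  = refl
... | false = refl

filter-map : ∀ {A B : Set} {P : B → Set} (P? : Decidable P) (f : A → B) xs →
  filter P? (List.map f xs) ≡ List.map f (filter (λ x → P? (f x)) xs)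
filter-map P? f []       = refl
filter-map P? f (x ∷ xs) with does (P? (f x))
... | true  = cong (f x ∷_) (filter-map P? f xs)
... | false = filter-map P? f xs

filter-∷ : ∀ {A : Set} {P : A → Set} (P? : Decidable P) x xs →
  filter P? (x ∷ xs) ≡ (if does (P? x) then x ∷ filter P? xs else filter P? xs)
filter-∷ P? x xs with does (P? x)
... | true  = refl
... | false = refl

Rmin≡rightMins : ∀ (s : Vec ℕ n) → Rmin s ≡ rightMins s
Rmin≡rightMins []      = refl
Rmin≡rightMins {suc n} (x ∷ s) = trans (cong (List.map (lookup (x ∷ s))) (filter-∷ (isRightToLeftMin? (x ∷ s)) zero (List.tabulate suc))) (head tail-eq)
  where
  open ≡-Reasoning
  first : Dec (IsRightToLeftMin (x ∷ s) zero)
  first = isRightToLeftMin? (x ∷ s) zero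
  first⇔ : IsRightToLeftMin (x ∷ s) zero ⇔ All (x <_) s
  first⇔ = mk⇔ (λ h → VecAll.lookup⁻ (λ j → h (suc j) z<s)) (λ { h (suc j) _ → VecAll.lookup⁺ h j })
  tail-eq : List.map (lookup (x ∷ s)) (filter (isRightToLeftMin? (x ∷ s)) (List.tabulate suc)) ≡ rightMins s
  tail-eq = begin
    List.map (lookup (x ∷ s)) (filter (isRightToLeftMin? (x ∷ s)) (List.tabulate suc))
      ≡⟨ cong (λ is → List.map (lookup (x ∷ s)) (filter (isRightToLeftMin? (x ∷ s)) is)) (List.map-tabulate id suc) ⟨
    List.map (lookup (x ∷ s)) (filter (isRightToLeftMin? (x ∷ s)) (List.map suc (List.allFin n)))
      ≡⟨ cong (List.map (lookup (x ∷ s))) (filter-map (isRightToLeftMin? (x ∷ s)) suc (List.allFin n)) ⟩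
    List.map (lookup (x ∷ s)) (List.map suc (filter (λ i → isRightToLeftMin? (x ∷ s) (suc i)) (List.allFin n)))
      ≡⟨ List.map-∘ _ ⟨
    List.map (lookup s) (filter (λ i → isRightToLeftMin? (x ∷ s) (suc i)) (List.allFin n))
      ≡⟨ cong (List.map (lookup s)) (List.filter-≐ _ (isRightToLeftMin? s) ((λ h j i<j → h (suc j) (s≤s i<j)) , (λ { h (suc j) (s≤s i<j) → h j i<j })) (List.allFin n)) ⟩
    Rmin s
      ≡⟨ Rmin≡rightMins s ⟩
    rightMins s ∎
  head : ∀ {is} → List.map (lookup (x ∷ s)) is ≡ rightMins s →
    List.map (lookup (x ∷ s)) (if does first then zero ∷ is else is) ≡ rightMins (x ∷ s)
  head eq rewrite does-⇔ first⇔ first (below? x s) with does (below? x s)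
  ... | true  = cong (x ∷_) eq
  ... | false = eq

-- Letters from decisions

letter : Dec P → Dec Q → Letter
letter (yes _) _       = peak
letter (no _)  (yes _) = used
letter (no _)  (no _)  = fresh

letter-peak : (P? : Dec P) (Q? : Dec Q) → P → letter P? Q? ≡ peak
letter-peak (yes _) _ _ = refl
letter-peak (no ¬p) _ p = contradiction p ¬p

letter-used : (P? : Dec P) (Q? : Dec Q) → ¬ P → Q → letter P? Q? ≡ used
letter-used (yes p) _       ¬p _ = contradiction p ¬p
letter-used (no _)  (yes _) _  _ = refl
letter-used (no _)  (no ¬q) _  q = contradiction q ¬q

letter-fresh : (P? : Dec P) (Q? : Dec Q) → ¬ P → ¬ Q → letter P? Q? ≡ fresh
letter-fresh (yes p) _       ¬p _ = contradiction p ¬p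
letter-fresh (no _)  (no _)  _  _ = refl
letter-fresh (no _)  (yes q) _ ¬q = contradiction q ¬q

letter-cong : (P? : Dec P) (Q? : Dec Q) (Q′? : Dec Q′) → (Q → Q′) → (Q′ → Q) → letter P? Q? ≡ letter P? Q′?
letter-cong (yes _) _       _        _ _ = refl
letter-cong (no _)  (yes _) (yes _)  _ _ = refl
letter-cong (no _)  (no _)  (no _)   _ _ = refl
letter-cong (no _)  (yes q) (no ¬q′) f _ = contradiction (f q) ¬q′
letter-cong (no _)  (no ¬q) (yes q′) _ g = contradiction (g q′) ¬q

-- For comparing a letter before (unprimed) and after (primed) an insertion at an earlier position.
letter-demote : (P? : Dec P) (Q? : Dec Q) (P′? : Dec P′) (Q′? : Dec Q′) →
  ¬ P′ → (P → Q′) → (Q → Q′) → (Q′ → P ⊎ Q) → letter P′? Q′? ≡ demote (letter P? Q?)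
letter-demote (yes p) _       P′? Q′? ¬p′ f g h = letter-used P′? Q′? ¬p′ (f p)
letter-demote (no ¬p) (yes q) P′? Q′? ¬p′ f g h = letter-used P′? Q′? ¬p′ (g q)
letter-demote (no ¬p) (no ¬q) P′? Q′? ¬p′ f g h = letter-fresh P′? Q′? ¬p′ (λ q′ → [ ¬p , ¬q ]′ (h q′))

-- Sums over the enumerated sequences

total : ∀ {A : Set} → (A → ℤ) → List A → ℤ
total f []       = 0ℤ
total f (x ∷ xs) = f x ℤ.+ total f xs

total-++ : ∀ {A : Set} (f : A → ℤ) xs ys → total f (xs ++ ys) ≡ total f xs ℤ.+ total f ys
total-++ f []       ys = sym (ℤ.+-identityˡ _)
total-++ f (x ∷ xs) ys = trans (cong (ℤ._+_ (f x)) (total-++ f xs ys)) (sym (ℤ.+-assoc (f x) _ _))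

total-map : ∀ {A B : Set} (f : B → ℤ) (g : A → B) xs → total f (List.map g xs) ≡ total (λ x → f (g x)) xs
total-map f g []       = refl
total-map f g (x ∷ xs) = cong (ℤ._+_ (f (g x))) (total-map f g xs)

total-cong : ∀ {A : Set} {f g : A → ℤ} {xs} → ListAll.All (λ x → f x ≡ g x) xs → total f xs ≡ total g xs
total-cong []         = refl
total-cong (eq ∷ eqs) = cong₂ ℤ._+_ eq (total-cong eqs)

total-concatMap : ∀ {A B : Set} (f : B → ℤ) (g : A → List B) xs →
  total f (concatMap g xs) ≡ total (λ x → total f (g x)) xs
total-concatMap f g []       = refl
total-concatMap f g (x ∷ xs) = trans (total-++ f (g x) _) (cong (ℤ._+_ (total f (g x))) (total-concatMap f g xs))

sequences : ∀ n → List (Vec ℕ n)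
sequences zero    = [ [] ]
sequences (suc n) = concatMap (insertions 0) (sequences n)

Insertion-Bounded : ∀ {k} {s : Vec ℕ n} {s′} → Insertion k s s′ → Bounded k s → Bounded k s′
Insertion-Bounded here        b         = ≤-refl , weaken _ b
  where
  weaken : ∀ {n k} (s : Vec ℕ n) → Bounded k s → Bounded (suc k) s
  weaken []      _         = tt
  weaken (x ∷ s) (x≤k , b) = m≤n⇒m≤1+n x≤k , weaken s b
Insertion-Bounded (there ins) (x≤k , b) = x≤k , Insertion-Bounded ins b

insertions-Insertion : ∀ k (s : Vec ℕ n) → ListAll.All (Insertion k s) (insertions k s)
insertions-Insertion k []      = here ∷ []
insertions-Insertion k (x ∷ s) = here ∷ ListAll.map⁺ (ListAll.map there (insertions-Insertion (suc k) s))

sequences-Bounded : ∀ n → ListAll.All (Bounded 0) (sequences n)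
sequences-Bounded zero    = tt ∷ []
sequences-Bounded (suc n) = ListAll.concat⁺ (ListAll.map⁺
  (ListAll.map (λ {s} b → ListAll.map (λ ins → Insertion-Bounded ins b) (insertions-Insertion 0 s)) (sequences-Bounded n)))

peaks-letter : (P? : Dec P) (Q? : Dec Q) (w : Word) →
  peaks (letter P? Q? ∷ w) ≡ (if does P? then suc else id) (peaks w)
peaks-letter (yes _) _       w = refl
peaks-letter (no _)  (yes _) w = refl
peaks-letter (no _)  (no _)  w = refl

infix 4 _∼?_ _≈?_

_∼?_ : (xs ys : List ℕ) → Dec (xs ∼[ set ] ys)
xs ∼? ys = map′
  (λ (sub , sup) → mk⇔ (ListAll.lookup sub) (ListAll.lookup sup))
  (λ eq → ListAll.tabulate (Equivalence.to eq) , ListAll.tabulate (Equivalence.from eq))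
  (ListAll.all? (λ x → member? _≟_ x ys) xs ×-dec ListAll.all? (λ y → member? _≟_ y xs) ys)

_≈?_ : (u v : Values) → Dec (u ≈ v)
(a , z , m , R) ≈? (a′ , z′ , m′ , R′) = a ≟ a′ ×-dec z ≟ z′ ×-dec m ≟ m′ ×-dec R ∼? R′

indicator : Dec P → ℤ
indicator P? = if does P? then 1ℤ else 0ℤ

total-indicator : ∀ {A : Set} {P : A → Set} (P? : Decidable P) xs →
  total (λ x → indicator (P? x)) xs ≡ + length (filter P? xs)
total-indicator P? []       = refl
total-indicator P? (x ∷ xs) with does (P? x)
... | true  = cong (ℤ._+_ 1ℤ) (total-indicator P? xs)
... | false = trans (ℤ.+-identityˡ _) (total-indicator P? xs)

-- The word of a sequence and the growth of totals

-- Used p x k s refers to the entry x at position k, preceded by p and followed by s.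
module Words
  (Used : ∀ {n} → ℕ → ℕ → ℕ → Vec ℕ n → Set)
  (Used? : ∀ {n} p x k (s : Vec ℕ n) → Dec (Used p x k s))
  (Used-insert : ∀ {n p x k} {s : Vec ℕ n} {s′} → Insertion (suc k) s s′ → Used p x k s′ ⇔ Used p x k s)
  where

  word : ℕ → ℕ → Vec ℕ n → Word
  word p k []      = []
  word p k (x ∷ s) = letter (x ≟ k) (Used? p x k s) ∷ word x (suc k) s

  word-Insertion-letter : ∀ {p x k} {s : Vec ℕ n} {s′} → Insertion (suc k) s s′ →
    letter (x ≟ k) (Used? p x k s′) ≡ letter (x ≟ k) (Used? p x k s)
  word-Insertion-letter ins = letter-cong _ _ _ (Equivalence.to (Used-insert ins)) (Equivalence.from (Used-insert ins))

  word-top : ∀ p k (s : Vec ℕ n) → word p k (top k s) ≡ word p k s ++ [ peak ]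
  word-top p k []      = cong [_] (letter-peak (k ≟ k) (Used? p k k []) refl)
  word-top p k (x ∷ s) = cong₂ _∷_ (word-Insertion-letter (top-Insertion (suc k) s)) (word-top x (suc k) s)

  -- `h` is general because dropping the first entry turns `toℕ` into `toℕ ∘ suc`; the offset `k`
  -- absorbs the shift.
  peaks-count : ∀ p k (s : Vec ℕ n) (h : Fin n → ℕ) → (∀ i → h i ≡ k + toℕ i) →
    peaks (word p k s) ≡ count (λ i → lookup s i ≟ h i) (allFin n)
  peaks-count p k []      h eq = refl
  peaks-count p k (x ∷ s) h eq = begin
    peaks (word p k (x ∷ s))
      ≡⟨ peaks-letter (x ≟ k) _ _ ⟩
    (if does (x ≟ k) then suc else id) (peaks (word x (suc k) s))
      ≡⟨ cong₂ (λ j c → (if does (x ≟ j) then suc else id) c)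
           (sym (trans (eq zero) (+-identityʳ k)))
           (peaks-count x (suc k) s (h ∘ suc) (λ i → trans (eq (suc i)) (+-suc k (toℕ i)))) ⟩
    (if does (x ≟ h zero) then suc else id) (count (λ i → lookup s i ≟ h (suc i)) (allFin _))
      ≡⟨ count-allFin (λ i → lookup (x ∷ s) i ≟ h i) ⟨
    count (λ i → lookup (x ∷ s) i ≟ h i) (allFin (suc _)) ∎
    where open ≡-Reasoning

  -- Position 0 has no letter, yet its entry 0 is always maximal.
  maxs≡1+peaks : ∀ (t : Vec ℕ n) → maxs (0 ∷ t) ≡ suc (peaks (word 0 1 t))
  maxs≡1+peaks t = trans (count-allFin (λ i → lookup (0 ∷ t) i ≟ toℕ i))
    (cong suc (sym (peaks-count 0 1 t (toℕ ∘ suc) (λ _ → refl))))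

  -- `word-shift` describes what lies behind an inserted `k`: the displaced entry `x` moves to
  -- position `suc k` and is now preceded by `k`.
  module _ (ρ : Rule)
    (word-shift : ∀ {n x k} (s : Vec ℕ n) → x ≤ k → Bounded (suc k) s → word k (suc k) (x ∷ s) ≡ ρ (word x (suc k) s))
    where

    -- Inner insertions match splits: the letters in front stay, the new entry is a peak, and
    -- `word-shift` gives the rest. An arbitrary `f` absorbs the letters already passed.
    total-inner : ∀ p k (s : Vec ℕ n) → Bounded k s → ∀ (f : Word → ℤ) →
      total (λ s′ → f (word p k s′)) (inner k s) ≡ splits (λ q r → f (q ++ peak ∷ ρ r)) (word p k s)
    total-inner p k []      _         f = refl
    total-inner p k (x ∷ s) (x≤k , b) f = cong₂ ℤ._+_
      (cong f (cong₂ _∷_ (letter-peak (k ≟ k) _ refl) (word-shift s x≤k b)))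
      (trans (total-map _ (x ∷_) (inner (suc k) s)) (trans
        (total-cong (ListAll.map (λ ins → cong (λ l → f (l ∷ _)) (word-Insertion-letter ins)) (inner-Insertion (suc k) s)))
        (total-inner x (suc k) s b (λ w → f (letter (x ≟ k) (Used? p x k s) ∷ w)))))

    module _ (θ : Weight) where
      open Growth θ

      weight : ℕ → Vec ℕ (suc n) → ℤ
      weight {n} m (x ∷ s) = grow ρ m (suc n) (word x 1 s) (zeros (x ∷ s)) (rightMins (x ∷ s))

      -- The summands of `grow`: insertion at 0 adds a zero and applies `ρ` to the whole word, inner
      -- insertions are splits, and the one at the end appends a peak and a minimum.
      total-insertions : ∀ (m : ℕ) (s : Vec ℕ (suc n)) → Bounded 0 s → total (weight m) (insertions 0 s) ≡ weight (suc m) s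
      total-insertions {n} m s@(.0 ∷ t) b@(z≤n , b₁) = begin
        total (weight m) (insertions 0 s)
          ≡⟨ cong (λ ss → total (weight m) ((0 ∷ s) ∷ List.map (0 ∷_) ss)) (insertions-inner-top 1 t) ⟩
        weight m (0 ∷ s) ℤ.+ total (weight m) (List.map (0 ∷_) (inner 1 t ++ [ top 1 t ]))
          ≡⟨ cong (ℤ._+_ (weight m (0 ∷ s))) (trans (total-map (weight m) (0 ∷_) (inner 1 t ++ [ top 1 t ])) (total-++ (λ s′ → weight m (0 ∷ s′)) (inner 1 t) [ top 1 t ])) ⟩
        weight m (0 ∷ s) ℤ.+ (total (λ s′ → weight m (0 ∷ s′)) (inner 1 t) ℤ.+ (weight m (0 ∷ top 1 t) ℤ.+ 0ℤ))
          ≡⟨ cong₂ ℤ._+_ bottom (cong₂ ℤ._+_ middle (trans (ℤ.+-identityʳ _) last)) ⟩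
        weight (suc m) s ∎
        where
        open ≡-Reasoning
        zeros-eq : ∀ {s′} → Insertion 1 t s′ → zeros (0 ∷ s′) ≡ zeros s
        zeros-eq {s′} ins = trans (zeros-∷ 0 s′) (trans (cong suc (zeros-Insertion ins)) (sym (zeros-∷ 0 t)))
        R-inner : ListAll.All (λ s′ → rightMins s′ ≡ rightMins s) (inner 0 s)
        R-inner = rightMins-inner 0 s b
        bottom : weight m (0 ∷ s) ≡ grow ρ m (2 + n) (ρ (word 0 1 t)) (suc (zeros s)) (rightMins s)
        bottom rewrite word-shift t z≤n b₁ | zeros-∷ 0 s | ListAll.head R-inner = refl
        middle : total (λ s′ → weight m (0 ∷ s′)) (inner 1 t) ≡
          splits (λ q r → grow ρ m (2 + n) (q ++ peak ∷ ρ r) (zeros s) (rightMins s)) (word 0 1 t)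
        middle = trans
          (total-cong (ListAll.zipWith
            (λ (ins , eq) → cong₂ (grow ρ m (2 + n) _) (zeros-eq ins) eq)
            (inner-Insertion 1 t , ListAll.map⁻ (ListAll.tail R-inner))))
          (total-inner 0 1 t b₁ (λ w → grow ρ m (2 + n) w (zeros s) (rightMins s)))
        last : weight m (0 ∷ top 1 t) ≡ grow ρ m (2 + n) (word 0 1 t ++ [ peak ]) (zeros s) (rightMins s ++ [ suc n ])
        last rewrite word-top 0 1 t | zeros-eq (top-Insertion 1 t) | rightMins-top 0 s b = refl

      -- Each step trades the last insertion of the enumeration for one more in the weight, until
      -- the sequence with single entry 0 is left: empty word, one zero, minimum 0.
      total-sequences : ∀ (n m : ℕ) → total (weight m) (sequences (suc n)) ≡ grow ρ (n + m) 1 [] 1 [ 0 ]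
      total-sequences zero    m = ℤ.+-identityʳ _
      total-sequences (suc n) m = begin
        total (weight m) (sequences (2 + n))
          ≡⟨ total-concatMap (weight m) (insertions 0) (sequences (suc n)) ⟩
        total (λ s → total (weight m) (insertions 0 s)) (sequences (suc n))
          ≡⟨ total-cong (ListAll.map (total-insertions m _) (sequences-Bounded (suc n))) ⟩
        total (weight (suc m)) (sequences (suc n))
          ≡⟨ total-sequences n (suc m) ⟩
        grow ρ (n + suc m) 1 [] 1 [ 0 ]
          ≡⟨ cong (λ i → grow ρ i 1 [] 1 [ 0 ]) (+-suc n m) ⟩
        grow ρ (suc n + m) 1 [] 1 [ 0 ] ∎
        where open ≡-Reasoning

    module _ (stat : ∀ {n} → Vec ℕ n → ℕ)
      (stat+freshes : ∀ {n} (t : Vec ℕ n) → Bounded 1 t → stat (0 ∷ t) + freshes (word 0 1 t) ≡ n)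
      where

      stats : Vec ℕ n → Values
      stats s = stat s , zeros s , maxs s , Rmin s

      length-filter-stats : ∀ n (v : Values) →
        + length (filter (λ s → stats s ≈? v) (sequences (suc n)))
          ≡ Growth.grow (λ f r z R → indicator ((n ∸ f , z , suc r , R) ≈? v)) ρ n 1 [] 1 [ 0 ]
      length-filter-stats n v = begin
        + length (filter (λ s → stats s ≈? v) (sequences (suc n)))
          ≡⟨ total-indicator (λ s → stats s ≈? v) (sequences (suc n)) ⟨
        total (λ s → indicator (stats s ≈? v)) (sequences (suc n))
          ≡⟨ total-cong (ListAll.map (λ {s} → stats-weight s) (sequences-Bounded (suc n))) ⟩
        total (weight θ 0) (sequences (suc n))
          ≡⟨ total-sequences θ n 0 ⟩
        Growth.grow θ ρ (n + 0) 1 [] 1 [ 0 ]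
          ≡⟨ cong (λ m → Growth.grow θ ρ m 1 [] 1 [ 0 ]) (+-identityʳ n) ⟩
        Growth.grow θ ρ n 1 [] 1 [ 0 ] ∎
        where
        open ≡-Reasoning
        -- By `stat+freshes`, `n ∸ f` is the statistic; `suc r` restores the maximal entry at
        -- position 0.
        θ : Weight
        θ f r z R = indicator ((n ∸ f , z , suc r , R) ≈? v)
        stats-weight : ∀ (s : Vec ℕ (suc n)) → Bounded 0 s → indicator (stats s ≈? v) ≡ weight θ 0 s
        stats-weight s@(.0 ∷ t) (z≤n , b) = cong (λ u → indicator (u ≈? v)) (cong₂ _,_
          (trans (sym (m+n∸n≡m _ (freshes (word 0 1 t)))) (cong (_∸ freshes (word 0 1 t)) (stat+freshes t b)))
          (cong (zeros s ,_) (cong₂ _,_ (maxs≡1+peaks t) (Rmin≡rightMins s))))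

-- The words for ascents and for distinct values

-- Inserting `k` between `p < k` and `x ≤ k` leaves exactly one ascent there, so `asc` is unchanged
-- exactly if `p < x`. For `dist`, the value `k` must occur already: as earlier entries are below
-- `k`, it does so at position `k`, as a peak, or later.
module Ascents   = Words (λ p x k s → p < x) (λ p x k s → p <? x) (λ _ → mk⇔ id id)
module Distincts = Words (λ p x k s → k ∈ᵛ s) (λ p x k s → k ∈? s)
  (λ ins → mk⇔ (Insertion-∈⁻ (n<1+n _) ins) (Insertion-∈⁺ ins))

-- After a move one place to the right no entry is a peak. A former peak `x = k` exceeds `p < k` and
-- becomes used; the test `p < x` ignores positions.
ascents-suc : ∀ {p k} (s : Vec ℕ n) → p < k → Bounded k s →
  Ascents.word p (suc k) s ≡ List.map demote (Ascents.word p k s)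
ascents-suc []      _   _         = refl
ascents-suc {p = p} {k} (x ∷ s) p<k (x≤k , b) = cong₂ _∷_
  (letter-demote (x ≟ k) (p <? x) (x ≟ suc k) (p <? x)
    (<⇒≢ (s≤s x≤k)) (λ { refl → p<k }) id inj₂)
  (ascents-suc s (s≤s x≤k) b)

-- The displaced `x` is below its new position and not above its new predecessor `k`, so its letter
-- is fresh.
ascents-shift : ∀ {x k} (s : Vec ℕ n) → x ≤ k → Bounded (suc k) s →
  Ascents.word k (suc k) (x ∷ s) ≡ ascRule (Ascents.word x (suc k) s)
ascents-shift {x = x} {k} s x≤k b = cong₂ _∷_
  (letter-fresh (x ≟ suc k) (k <? x) (<⇒≢ (s≤s x≤k)) (≤⇒≯ x≤k))
  (ascents-suc s (s≤s x≤k) b)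

-- The letter at position `k` concerns the value `k`. With a smaller `y` put in front, `k` occurs
-- behind this position exactly if it occurred at or behind it before. The new last position has
-- nothing behind it and is fresh.
distincts-shift : ∀ {p q y k} (s : Vec ℕ n) → y < k → Bounded k s →
  Distincts.word p k (y ∷ s) ≡ distRule (Distincts.word q k s)
distincts-shift {y = y} {k} []      y<k _ = cong [_] (letter-fresh (y ≟ k) (k ∈? []) (<⇒≢ y<k) λ ())
distincts-shift {y = y} {k} (x ∷ s) y<k (x≤k , b) = cong₂ _∷_
  (letter-demote (x ≟ k) (k ∈? s) (y ≟ k) (k ∈? (x ∷ s)) (<⇒≢ y<k)
    (λ { refl → here refl }) there (λ { (here refl) → inj₁ refl ; (there i) → inj₂ i }))
  (distincts-shift {p = y} {q = x} s (s≤s x≤k) b)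

-- Each pair of neighbours gives an ascent or a fresh letter, never both; a peak `x = k` is an
-- ascent because `p < k`.
asc+freshes : ∀ p k (s : Vec ℕ n) → p < k → Bounded k s → asc (p ∷ s) + freshes (Ascents.word p k s) ≡ n
asc+freshes p k []      _   _         = refl
asc+freshes {suc n} p k (x ∷ s) p<k (x≤k , b) = begin
  asc (p ∷ x ∷ s) + freshes (Ascents.word p k (x ∷ s))
    ≡⟨ cong (_+ freshes (Ascents.word p k (x ∷ s))) (count-allFin (λ i → lookup (p ∷ x ∷ s) (inject₁ i) <? lookup (x ∷ s) i)) ⟩
  (if does (p <? x) then suc else id) (asc (x ∷ s)) + freshes (letter (x ≟ k) (p <? x) ∷ w)
    ≡⟨ step (x ≟ k) (p <? x) (λ { refl → p<k }) ⟩
  suc (asc (x ∷ s) + freshes w)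
    ≡⟨ cong suc (asc+freshes x (suc k) s (s≤s x≤k) b) ⟩
  suc n ∎
  where
  open ≡-Reasoning
  w = Ascents.word x (suc k) s
  step : (P? : Dec P) (Q? : Dec Q) → (P → Q) →
    (if does Q? then suc else id) (asc (x ∷ s)) + freshes (letter P? Q? ∷ w) ≡ suc (asc (x ∷ s) + freshes w)
  step (yes p) (no ¬q) f = contradiction (f p) ¬q
  step (yes _) (yes _) _ = refl
  step (no _)  (yes _) _ = refl
  step (no _)  (no _)  _ = +-suc (asc (x ∷ s)) (freshes w)

-- For a word of `Distincts` these positions are also the values from `k` on that occur in the tail,
-- so counting letters counts distinct values.
nonfresh : ℕ → Word → List ℕ
nonfresh k []          = []
nonfresh k (peak ∷ w)  = k ∷ nonfresh (suc k) w
nonfresh k (used ∷ w)  = k ∷ nonfresh (suc k) w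
nonfresh k (fresh ∷ w) = nonfresh (suc k) w

nonfresh-≥ : ∀ k w → ListAll.All (k ≤_) (nonfresh k w)
nonfresh-≥ k []          = []
nonfresh-≥ k (peak ∷ w)  = ≤-refl ∷ ListAll.map <⇒≤ (nonfresh-≥ (suc k) w)
nonfresh-≥ k (used ∷ w)  = ≤-refl ∷ ListAll.map <⇒≤ (nonfresh-≥ (suc k) w)
nonfresh-≥ k (fresh ∷ w) = ListAll.map <⇒≤ (nonfresh-≥ (suc k) w)

nonfresh-Unique : ∀ k w → Unique (nonfresh k w)
nonfresh-Unique k []          = []
nonfresh-Unique k (peak ∷ w)  = ListAll.map <⇒≢ (nonfresh-≥ (suc k) w) ∷ nonfresh-Unique (suc k) w
nonfresh-Unique k (used ∷ w)  = ListAll.map <⇒≢ (nonfresh-≥ (suc k) w) ∷ nonfresh-Unique (suc k) w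
nonfresh-Unique k (fresh ∷ w) = nonfresh-Unique (suc k) w

nonfresh+freshes : ∀ k w → length (nonfresh k w) + freshes w ≡ length w
nonfresh+freshes k []          = refl
nonfresh+freshes k (peak ∷ w)  = cong suc (nonfresh+freshes (suc k) w)
nonfresh+freshes k (used ∷ w)  = cong suc (nonfresh+freshes (suc k) w)
nonfresh+freshes k (fresh ∷ w) = trans (+-suc _ (freshes w)) (cong suc (nonfresh+freshes (suc k) w))

length-word : ∀ p k (s : Vec ℕ n) → length (Distincts.word p k s) ≡ n
length-word p k []      = refl
length-word p k (x ∷ s) = cong suc (length-word x (suc k) s)

nonfresh-∈⁻ : ∀ {j} p k (s : Vec ℕ n) → j ∈ nonfresh k (Distincts.word p k s) → j ∈ᵛ s
nonfresh-∈⁻ p k (x ∷ s) i with x ≟ k | k ∈? s | i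
... | yes refl | _       | here refl = here refl
... | yes _    | _       | there i′  = there (nonfresh-∈⁻ x (suc k) s i′)
... | no _     | yes k∈s | here refl = there k∈s
... | no _     | yes _   | there i′  = there (nonfresh-∈⁻ x (suc k) s i′)
... | no _     | no _    | i′        = there (nonfresh-∈⁻ x (suc k) s i′)

nonfresh-∈⁺ : ∀ {j} p k (s : Vec ℕ n) → Bounded k s → k ≤ j → j ∈ᵛ s → j ∈ nonfresh k (Distincts.word p k s)
nonfresh-∈⁺ {j = j} p k (x ∷ s) (x≤k , b) k≤j i with x ≟ k | k ∈? s | m≤n⇒m<n∨m≡n k≤j | i
... | yes _  | _      | inj₂ refl | _         = here refl
... | no _   | yes _  | inj₂ refl | _         = here refl
... | no x≢k | no _   | inj₂ refl | here e    = contradiction (sym e) x≢k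
... | no _   | no k∉s | inj₂ refl | there i′  = contradiction i′ k∉s
... | _      | _      | inj₁ k<j  | here refl = contradiction k<j (≤⇒≯ x≤k)
... | yes _  | _      | inj₁ k<j  | there i′  = there (nonfresh-∈⁺ x (suc k) s b k<j i′)
... | no _   | yes _  | inj₁ k<j  | there i′  = there (nonfresh-∈⁺ x (suc k) s b k<j i′)
... | no _   | no _   | inj₁ k<j  | there i′  = nonfresh-∈⁺ x (suc k) s b k<j i′

dist+freshes : ∀ (t : Vec ℕ n) → Bounded 1 t → dist (0 ∷ t) + freshes (Distincts.word 0 1 t) ≡ n
dist+freshes {n} t b = begin
  dist (0 ∷ t) + freshes w
    -- Duplicate-free lists with the same elements have equal length. The added `peak` stands for
    -- the value 0, which `∸ 1` discounts.
    ≡⟨ cong (λ l → l ∸ 1 + freshes w) (↭-length (∼bag⇒↭ (unique∧set⇒bag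
         (deduplicate-! _≟_ (toList (0 ∷ t))) (nonfresh-Unique 0 (peak ∷ w)) same-elements))) ⟩
  length (nonfresh 1 w) + freshes w
    ≡⟨ nonfresh+freshes 1 w ⟩
  length w
    ≡⟨ length-word 0 1 t ⟩
  n ∎
  where
  open ≡-Reasoning
  w = Distincts.word 0 1 t
  same-elements : deduplicate _≟_ (toList (0 ∷ t)) ∼[ set ] nonfresh 0 (peak ∷ w)
  same-elements = mk⇔
    (λ i → nonfresh-∈⁺ 0 0 (0 ∷ t) (z≤n , b) z≤n (∈-toList⁻ (List.∈-deduplicate⁻ _≟_ (toList (0 ∷ t)) i)))
    (λ i → List.∈-deduplicate⁺ _≟_ (∈-toList⁺ (nonfresh-∈⁻ 0 0 (0 ∷ t) i)))

equinumerous : ∀ n (v : Values) →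
  length (filter (λ s → (asc s , zeros s , maxs s , Rmin s) ≈? v) (sequences (suc n))) ≡
  length (filter (λ s → (dist s , zeros s , maxs s , Rmin s) ≈? v) (sequences (suc n)))
equinumerous n v = ℤ.+-injective (trans
  (Ascents.length-filter-stats ascRule ascents-shift asc (λ t b → asc+freshes 0 1 t z<s b) n v)
  (trans (Growth.grow-asc≡grow-dist _ n 1 [] 1 [ 0 ])
  (sym (Distincts.length-filter-stats distRule (λ {_} {x} {k} s x≤k b → distincts-shift {p = k} {q = x} s (s≤s x≤k) b) dist dist+freshes n v))))

-- The enumeration is complete and without repetitions

-- The inserted value attains the bound counted from `suc k`, one more than the bound from `k`
-- permits.
¬Insertion-Bounded : ∀ {k} {s : Vec ℕ n} {s′} → Insertion (suc k) s s′ → ¬ Bounded k s′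
¬Insertion-Bounded here        (k<k , _) = <-irrefl refl k<k
¬Insertion-Bounded (there ins) (_ , b)   = ¬Insertion-Bounded ins b

-- Behind an inserted value the displaced entries stay strictly below their new positions, so no
-- second insertion can have taken place further right.
Insertion-injective : ∀ {k} {r s : Vec ℕ n} {s′} → Bounded k r → Bounded k s →
  Insertion k r s′ → Insertion k s s′ → r ≡ s
Insertion-injective _        _        here      here      = refl
Insertion-injective b        _        here      (there j) = contradiction b (¬Insertion-Bounded j)
Insertion-injective _        b        (there i) here      = contradiction b (¬Insertion-Bounded i)
Insertion-injective (_ , b)  (_ , b′) (there i) (there j) = cong (_ ∷_) (Insertion-injective b b′ i j)

∈-insertions⁻ : ∀ {k} {s : Vec ℕ n} {s′} → s′ ∈ insertions k s → Insertion k s s′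
∈-insertions⁻ = ListAll.lookup (insertions-Insertion _ _)

insertions-Unique : ∀ k (s : Vec ℕ n) → Bounded k s → Unique (insertions k s)
insertions-Unique k []      _           = [] ∷ []
insertions-Unique k (x ∷ s) (x≤k , b) =
  ListAll.map⁺ (ListAll.map (λ ins eq → not-bounded ins (proj₂ (Vec.∷-injective eq))) (insertions-Insertion (suc k) s))
  ∷ map⁺ Vec.∷-injectiveʳ (insertions-Unique (suc k) s b)
  where
  not-bounded : ∀ {s′} → Insertion (suc k) s s′ → ¬ (x ∷ s ≡ s′)
  not-bounded ins refl = ¬Insertion-Bounded ins (x≤k , b)

concatMap-Unique : ∀ {A B : Set} {f : A → List B} {xs} →
  ListAll.All (Unique ∘ f) xs →
  (∀ {x y v} → x ∈ xs → y ∈ xs → v ∈ f x → v ∈ f y → x ≡ y) →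
  Unique xs → Unique (concatMap f xs)
concatMap-Unique []       _   _          = []
concatMap-Unique {f = f} {x ∷ xs} (u ∷ us) inj (x∉xs ∷ uxs) = ++⁺ u
  (concatMap-Unique us (λ i j → inj (there i) (there j)) uxs)
  λ (v∈fx , v∈fxs) → let (y , y∈xs , v∈fy) = find (List.∈-concatMap⁻ f {xs = xs} v∈fxs) in
    ListAll.lookup x∉xs y∈xs (inj (here refl) (there y∈xs) v∈fx v∈fy)

sequences-Unique : ∀ n → Unique (sequences n)
sequences-Unique zero    = [] ∷ []
sequences-Unique (suc n) = concatMap-Unique
  (ListAll.map (insertions-Unique 0 _) (sequences-Bounded n))
  (λ i j i′ j′ → Insertion-injective (bounded i) (bounded j) (∈-insertions⁻ i′) (∈-insertions⁻ j′))
  (sequences-Unique n)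
  where
  bounded : ∀ {s} → s ∈ sequences n → Bounded 0 s
  bounded = ListAll.lookup (sequences-Bounded n)

head-∈-insertions : ∀ k (s : Vec ℕ n) → k ∷ s ∈ insertions k s
head-∈-insertions k []      = here refl
head-∈-insertions k (x ∷ s) = here refl

Inserted : ℕ → Vec ℕ n → Set
Inserted k []        = ⊥
Inserted k s′@(_ ∷ _) = ∃[ s ] Bounded k s × s′ ∈ insertions k s

-- The last position whose value is maximal is where the value was inserted.
bounded-or-inserted : ∀ k (s : Vec ℕ n) → Bounded (suc k) s → Bounded k s ⊎ Inserted (suc k) s
bounded-or-inserted k []      _ = inj₁ tt
bounded-or-inserted k (x ∷ s) (x≤1+k , b) with bounded-or-inserted (suc k) s b
bounded-or-inserted k (x ∷ s@(_ ∷ _)) (x≤1+k , b) | inj₂ (r , b′ , i) =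
  inj₂ (x ∷ r , (x≤1+k , b′) , there (List.∈-map⁺ (x ∷_) i))
... | inj₁ b′ with m≤n⇒m<n∨m≡n x≤1+k
...   | inj₁ x<1+k = inj₁ (s≤s⁻¹ x<1+k , b′)
...   | inj₂ refl  = inj₂ (s , b′ , head-∈-insertions x s)

inserted : ∀ (s : Vec ℕ (suc n)) → Bounded 0 s → Inserted 0 s
inserted (.0 ∷ t) (z≤n , b) with bounded-or-inserted 0 t b
... | inj₁ b′ = t , b′ , head-∈-insertions 0 t
inserted (.0 ∷ t@(_ ∷ _)) (z≤n , b) | inj₂ (r , b′ , i) = 0 ∷ r , (z≤n , b′) , there (List.∈-map⁺ (0 ∷_) i)

sequences-complete : ∀ (s : Vec ℕ n) → Bounded 0 s → s ∈ sequences n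
sequences-complete []          _ = here refl
sequences-complete s@(_ ∷ _) b with inserted s b
... | r , b′ , i = List.∈-concatMap⁺ (insertions 0) (lose (sequences-complete r b′) i)

-- Cardinalities of the fibres

lookup⇒Bounded : ∀ k (s : Vec ℕ n) → (∀ i → lookup s i < suc (k + toℕ i)) → Bounded k s
lookup⇒Bounded k []      h = tt
lookup⇒Bounded k (x ∷ s) h = subst (x ≤_) (+-identityʳ k) (s≤s⁻¹ (h zero)) ,
  lookup⇒Bounded (suc k) s (λ i → subst (lookup s i <_) (cong suc (+-suc k (toℕ i))) (h (suc i)))

Bounded⇒lookup : ∀ k (s : Vec ℕ n) → Bounded k s → ∀ i → lookup s i < suc (k + toℕ i)
Bounded⇒lookup k (x ∷ s) (x≤k , b) zero    = s≤s (subst (x ≤_) (sym (+-identityʳ k)) x≤k)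
Bounded⇒lookup k (x ∷ s) (x≤k , b) (suc i) = subst (lookup s i <_) (cong suc (sym (+-suc k (toℕ i)))) (Bounded⇒lookup (suc k) s b i)

lookup-injective : ∀ {A : Set} {xs : List A} → Unique xs → ∀ i j → List.lookup xs i ≡ List.lookup xs j → i ≡ j
lookup-injective (x∉xs ∷ u) zero    zero    eq = refl
lookup-injective (x∉xs ∷ u) zero    (suc j) eq = contradiction eq (ListAll.lookup x∉xs (List.∈-lookup j))
lookup-injective (x∉xs ∷ u) (suc i) zero    eq = contradiction (sym eq) (ListAll.lookup x∉xs (List.∈-lookup i))
lookup-injective (x∉xs ∷ u) (suc i) (suc j) eq = cong suc (lookup-injective u i j eq)

Fibre-cardinality : ∀ n (stats : Vec ℕ n → Values) v →
  HasCardinality (Fibre {InvSeq n} (λ σ → stats (value σ)) v) (length (filter (λ s → stats s ≈? v) (sequences n)))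
Fibre-cardinality n stats v = mk⤖ {to = element} (injective , surjective)
  where
  ss = filter (λ s → stats s ≈? v) (sequences n)
  lookup-∈ : ∀ i → List.lookup ss i ∈ sequences n × stats (List.lookup ss i) ≈ v
  lookup-∈ i = List.∈-filter⁻ (λ s → stats s ≈? v) (List.∈-lookup i)
  element : Fin (length ss) → Fibre {InvSeq n} (λ σ → stats (value σ)) v
  element i = (List.lookup ss i , irr (Bounded⇒lookup 0 _ (ListAll.lookup (sequences-Bounded n) (proj₁ (lookup-∈ i)))))
            , irr (proj₂ (lookup-∈ i))
  injective : ∀ {i j} → element i ≡ element j → i ≡ j
  injective eq = lookup-injective (filter⁺ (λ s → stats s ≈? v) (sequences-Unique n)) _ _ (cong (value ∘ value) eq)
  surjective : ∀ σ → ∃[ i ] (∀ {j} → j ≡ i → element j ≡ σ)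
  surjective ((s , irr b) , irr e) = index s∈ss , λ { refl → equal (sym (lookup-index s∈ss)) }
    where
    -- The proofs inside a refinement are irrelevant; decidability of the conditions allows
    -- recomputing them.
    bounds : ∀ i → lookup s i < suc (toℕ i)
    bounds = recompute (Fin.all? (λ i → lookup s i <? suc (toℕ i))) b
    s∈ss : s ∈ ss
    s∈ss = List.∈-filter⁺ (λ s → stats s ≈? v) (sequences-complete s (lookup⇒Bounded 0 s bounds)) (recompute (stats s ≈? v) e)
    -- Once the sequences agree, the remaining components are irrelevant and hence equal by
    -- definition.
    equal : ∀ {τ : Fibre {InvSeq n} (λ σ → stats (value σ)) v} → value (value τ) ≡ s → τ ≡ ((s , irr b) , irr e)
    equal refl = refl

theorem15 : ∀ (n : ℕ) → n ≥ 1 → SameDistribution (asc-zero-max-Rmin {n}) (dist-zero-max-Rmin {n})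
theorem15 (suc n) _ v = _ , Fibre-cardinality (suc n) _ v ,
  subst (HasCardinality _) (sym (equinumerous n v)) (Fibre-cardinality (suc n) _ v)
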